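{- For all $n\ge 0$, the quadruples of statistics $(\operatorname{asc},\operatorname{des},\operatorname{MNA},\operatorname{MND})$ and $(\operatorname{des},\operatorname{asc},\operatorname{MND},\operatorname{MNA})$ are equidistributed on $S_n(213,312)$, i.e. $$\sum_{\pi\in S_n(213,312)} t_1^{\operatorname{asc}(\pi)}t_2^{\operatorname{des}(\pi)}t_3^{\operatorname{MNA}(\pi)}t_4^{\operatorname{MND}(\pi)}=\sum_{\pi\in S_n(213,312)} t_1^{\operatorname{des}(\pi)}t_2^{\operatorname{asc}(\pi)}t_3^{\operatorname{MND}(\pi)}t_4^{\operatorname{MNA}(\pi)}.$$
   Context: For $n\ge 0$, $S_n$ denotes the set of permutations $\pi=\pi_1\cdots\pi_n$ of $[n]=\{1,\dots,n\}$. $\pi$ avoids a pattern $\tau\in S_k$ if no subsequence $\pi_{i_1}\cdots\pi_{i_k}$ ($i_1<\dots<i_k$) satisfies $\pi_{i_a}<\pi_{i_b}\iff\tau_a<\tau_b$; $S_n(\tau,\rho)$ is the set of permutations in $S_n$ avoiding both $\tau$ and $\rho$. $\operatorname{asc}(\pi)$ (resp. $\operatorname{des}(\pi)$) is the number of $i\in[n-1]$ with $\pi_i<\pi_{i+1}$ (resp. $\pi_i>\pi_{i+1}$). $\operatorname{MNA}(\pi)$ is the maximum size of a set $I\subseteq[n-1]$ such that $\pi_i<\pi_{i+1}$ for all $i\in I$ and $|i-j|\ge 2$ for distinct $i,j\in I$; $\operatorname{MND}(\pi)$ is defined analogously with $\pi_i>\pi_{i+1}$. -}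

module Defs where

open import Algebra.Bundles using (CommutativeSemiring)
open import Data.Fin as Fin using (Fin; zero; suc; toℕ; inject₁; #_)
open import Data.Fin.Properties as Finₚ using (all?)
open import Data.Fin.Subset using (Subset; inside; outside; _∈_; ∣_∣)
open import Data.Fin.Subset.Properties using (_∈?_)
open import Data.List using (List; []; _∷_; map; filter; length; foldr; allFin; cartesianProductWith)
open import Data.List.Extrema.Nat using (max)
open import Data.Nat using (ℕ; zero; suc; pred; _≤_; _≤?_; ∣_-_∣)
import Data.Nat.Properties as ℕₚ
open import Data.Product using (_×_; _,_; ∃)
open import Data.Product.Properties using (≡-dec)
open import Data.Vec using (Vec; []; _∷_; lookup)
import Data.Vec.Relation.Unary.AllPairs as AllPairs
open import Data.Vec.Relation.Unary.Unique.Propositional using (Unique)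
open import Function.Bundles using (_⇔_; mk⇔; Equivalence)
open import Level using (Level; 0ℓ)
open import Relation.Binary.Definitions using (DecidableEquality)
open import Relation.Binary.PropositionalEquality using (_≡_; _≢_)
open import Relation.Nullary using (¬_; Dec; ¬?; _×-dec_; _→-dec_)
open import Relation.Nullary.Decidable using (map′)
open import Relation.Unary using (Pred; Decidable)

private
  variable
    a p : Level
    A : Set a
    k m n : ℕ

vectors : List A → ∀ n → List (Vec A n)
vectors xs zero    = [] ∷ []
vectors xs (suc n) = cartesianProductWith _∷_ xs (vectors xs n)

anyVec? : ∀ k {P : Pred (Vec (Fin n) k) p} → Decidable P → Dec (∃ P)
anyVec? zero    P? = map′ (λ q → [] , q) (λ { ([] , q) → q }) (P? [])
anyVec? (suc k) P? =
  map′ (λ { (x , xs , q) → (x ∷ xs) , q }) (λ { (x ∷ xs , q) → x , xs , q })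
       (Finₚ.any? λ x → anyVec? k λ xs → P? (x ∷ xs))

_⇔-dec_ : {P Q : Set} → Dec P → Dec Q → Dec (P ⇔ Q)
p? ⇔-dec q? =
  map′ (λ { (f , g) → mk⇔ f g }) (λ e → Equivalence.to e , Equivalence.from e)
       ((p? →-dec q?) ×-dec (q? →-dec p?))

-- One-line notation π₁⋯πₙ, with positions and values shifted from [n] to
-- {0,…,n-1}; an n-letter word is a permutation as soon as its letters are
-- distinct.

Word : ℕ → Set
Word n = Vec (Fin n) n

IsPermutation : Word n → Set
IsPermutation π = Unique π

isPermutation? : Decidable (IsPermutation {n})
isPermutation? = AllPairs.allPairs? λ x y → ¬? (x Fin.≟ y)

permutations : ∀ n → List (Word n)
permutations n = filter isPermutation? (vectors (allFin n) n)

Increasing : Vec (Fin n) k → Set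
Increasing is = ∀ a b → a Fin.< b → lookup is a Fin.< lookup is b

Occurrence : Word k → Word n → Vec (Fin n) k → Set
Occurrence τ π is =
  Increasing is ×
  (∀ a b → lookup π (lookup is a) Fin.< lookup π (lookup is b) ⇔
           lookup τ a Fin.< lookup τ b)

Avoids : Word k → Word n → Set
Avoids τ π = ¬ ∃ (Occurrence τ π)

avoids? : (τ : Word k) → Decidable (Avoids {n = n} τ)
avoids? {k} τ π = ¬? (anyVec? k λ is →
  all? (λ a → all? λ b → (a Fin.<? b) →-dec (lookup is a Fin.<? lookup is b))
  ×-dec
  all? (λ a → all? λ b →
    (lookup π (lookup is a) Fin.<? lookup π (lookup is b)) ⇔-dec
    (lookup τ a Fin.<? lookup τ b)))

S : ∀ n → Word k → Word m → List (Word n)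
S n τ ρ = filter (λ π → avoids? τ π ×-dec avoids? ρ π) (permutations n)

[213] [312] : Word 3
[213] = # 1 ∷ # 0 ∷ # 2 ∷ []
[312] = # 2 ∷ # 0 ∷ # 1 ∷ []

-- The index set [n-1] is Fin (pred n), which is empty for n = 0 and n = 1.

Ascent : Vec (Fin m) n → Pred (Fin (pred n)) 0ℓ
Ascent {n = suc _} π i = lookup π (inject₁ i) Fin.< lookup π (suc i)

Descent : Vec (Fin m) n → Pred (Fin (pred n)) 0ℓ
Descent {n = suc _} π i = lookup π (inject₁ i) Fin.> lookup π (suc i)

ascent? : (π : Vec (Fin m) n) → Decidable (Ascent π)
ascent? {n = suc _} π i = lookup π (inject₁ i) Fin.<? lookup π (suc i)

descent? : (π : Vec (Fin m) n) → Decidable (Descent π)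
descent? {n = suc _} π i = lookup π (suc i) Fin.<? lookup π (inject₁ i)

count : {P : Pred A p} → Decidable P → List A → ℕ
count P? xs = length (filter P? xs)

asc des : Word n → ℕ
asc {n} π = count (ascent? π) (allFin (pred n))
des {n} π = count (descent? π) (allFin (pred n))

NonOverlapping : Pred (Fin k) p → Subset k → Set p
NonOverlapping P I =
  (∀ i → i ∈ I → P i) ×
  (∀ i j → i ∈ I → j ∈ I → i ≢ j → 2 ≤ ∣ toℕ i - toℕ j ∣)

nonOverlapping? : {P : Pred (Fin k) p} → Decidable P → Decidable (NonOverlapping P)
nonOverlapping? P? I =
  all? (λ i → (i ∈? I) →-dec P? i)
  ×-dec
  all? (λ i → all? λ j →
    (i ∈? I) →-dec ((j ∈? I) →-dec
      (¬? (i Fin.≟ j) →-dec (2 ≤? ∣ toℕ i - toℕ j ∣))))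

subsets : ∀ k → List (Subset k)
subsets = vectors (inside ∷ outside ∷ [])

-- The empty set is always admissible, so the default value 0 does not affect
-- the maximum.
maxNonOverlapping : {P : Pred (Fin k) p} → Decidable P → ℕ
maxNonOverlapping {k} P? = max 0 (map ∣_∣ (filter (nonOverlapping? P?) (subsets k)))

MNA MND : Word n → ℕ
MNA π = maxNonOverlapping (ascent? π)
MND π = maxNonOverlapping (descent? π)

Quadruple : Set
Quadruple = ℕ × ℕ × ℕ × ℕ

_≟⁴_ : DecidableEquality Quadruple
_≟⁴_ = ≡-dec ℕₚ._≟_ (≡-dec ℕₚ._≟_ (≡-dec ℕₚ._≟_ ℕₚ._≟_))

-- The list stands for a finite set, so it should be free of repetitions.
Equidistributed : List A → (A → Quadruple) → (A → Quadruple) → Set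
Equidistributed xs f g =
  ∀ v → count (λ x → f x ≟⁴ v) xs ≡ count (λ x → g x ≟⁴ v) xs

-- An identity of polynomials with coefficients in ℕ is the same as an identity
-- of their values at all points of all commutative semirings (among which is
-- the polynomial semiring itself), so t₁,…,t₄ range over such points.

module Evaluation {c ℓ} (R : CommutativeSemiring c ℓ) where
  open CommutativeSemiring R public
    using (Carrier; _≈_; _+_; _*_; 0#; semiring)
  open import Algebra.Properties.Semiring.Exp semiring public using (_^_)

  ∑ : List A → (A → Carrier) → Carrier
  ∑ xs f = foldr (λ x s → f x + s) 0# xs

-- Reversing a permutation turns 213 into 312 and exchanges ascents with
-- descents, so it is an involution of S n [213] [312] along which one quadruple
-- of statistics becomes the other.  Both parts of the theorem depend only on the
-- multiset of values of the quadruple.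
module Submission where

open import Defs
open import Algebra.Bundles using (CommutativeSemiring)
open import Data.Bool using (true; false)
open import Data.Fin as Fin using (Fin; zero; suc; toℕ; fromℕ; inject₁; opposite)
open import Data.Fin.Properties using (opposite-prop; opposite-involutive; toℕ<n)
open import Data.Fin.Subset using (Subset; Side; inside; outside; _∈_; ∣_∣)
open import Data.List using (List; []; _∷_; map; filter; foldr; length; allFin)
open import Data.List.Extrema.Nat using (max[xs]≤max[ys]⁺)
import Data.List.Membership.Propositional as List
open import Data.List.Membership.Propositional.Properties
  using (∈-map⁺; ∈-map⁻; ∈-filter⁺; ∈-filter⁻; ∈-allFin; ∈-cartesianProductWith⁺)
open import Data.List.Membership.Propositional.Properties.WithK using (unique∧set⇒bag)
open import Data.List.Properties using (map-∘; map-cong; filter-≐; foldr-map)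
open import Data.List.Relation.Binary.BagAndSetEquality using (∼bag⇒↭)
open import Data.List.Relation.Binary.Permutation.Propositional
  using (_↭_; ↭-reflexive; ↭-trans; ↭⇒↭ₛ′)
open import Data.List.Relation.Binary.Permutation.Propositional.Properties
  using (↭-length; filter-↭) renaming (map⁺ to ↭-map⁺)
import Data.List.Relation.Binary.Permutation.Setoid.Properties as Permutationₛ
import Data.List.Relation.Unary.All as All
open import Data.List.Relation.Unary.Any as Any using (here; there)
import Data.List.Relation.Unary.Unique.Propositional as List
import Data.List.Relation.Unary.Unique.Propositional.Properties as Listᵤ
open import Data.Nat as Nat using (ℕ; zero; suc; pred; _≤_; ∣_-_∣)
open import Data.Nat.Properties
  using (∸-monoʳ-<; m∸n+n≡m; +-comm; +-assoc; ∣m+n-m+o∣≡∣n-o∣; ∣-∣-comm; ≤-antisym; ≤-refl; ≤-reflexive)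
open import Data.Product using (_×_; _,_; proj₂)
open import Data.Sum using (inj₁; inj₂)
open import Data.Vec using (Vec; []; _∷_; _∷ʳ_; lookup; reverse; tabulate)
import Data.Vec as Vec
open import Data.Vec.Properties
  using (reverse-∷; reverse-involutive; lookup-map; tabulate∘lookup; tabulate-cong;
         ∷-injective; []=⇒lookup; lookup⇒[]=)
open import Data.Vec.Relation.Unary.Unique.Propositional using (Unique)
open import Data.Vec.Relation.Unary.Unique.Propositional.Properties using (tabulate⁺; lookup-injective)
open import Function using (_∘_; _⇔_; mk⇔)
open import Level using (Level)
open import Relation.Binary.PropositionalEquality
  using (_≡_; refl; sym; trans; cong; cong₂; subst; subst₂; module ≡-Reasoning)
open import Relation.Nullary using (does)
open import Relation.Unary using (Pred; Decidable; _⊆_; _≐_)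

private
  variable
    a p q : Level
    A B : Set a
    k m n : ℕ

-- Reflection of positions

opposite-< : {i j : Fin n} → i Fin.< j → opposite j Fin.< opposite i
opposite-< {i = i} {j} i<j =
  subst₂ Nat._<_ (sym (opposite-prop j)) (sym (opposite-prop i))
    (∸-monoʳ-< (Nat.s≤s i<j) (toℕ<n j))

-- Companion to the defining clause `opposite (suc i) = inject₁ (opposite i)`: the two describe how
-- reflection exchanges the left and right ends of a pair of adjacent positions.
opposite-inject₁ : (i : Fin n) → opposite (inject₁ i) ≡ suc (opposite i)
opposite-inject₁ zero    = refl
opposite-inject₁ (suc i) = cong inject₁ (opposite-inject₁ i)

-- Since `toℕ (opposite l) + suc (toℕ l)` is `n`, adding `n` to both `i′` and `j′` exposes a common
-- summand `i′ + j′`. Cancelling it leaves the successors of `toℕ j` and `toℕ i`, and truncated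
-- subtraction never has to be rearranged.
opposite-distance : (i j : Fin n) → ∣ toℕ (opposite i) - toℕ (opposite j) ∣ ≡ ∣ toℕ i - toℕ j ∣
opposite-distance {n} i j = begin
  ∣ i′ - j′ ∣                                ≡⟨ ∣m+n-m+o∣≡∣n-o∣ n i′ j′ ⟨
  ∣ n + i′ - n + j′ ∣                        ≡⟨ cong₂ ∣_-_∣ (shift j i′)
                                                  (trans (shift i j′) (cong (_+ suc (toℕ i)) (+-comm j′ i′))) ⟩
  ∣ i′ + j′ + suc (toℕ j) - i′ + j′ + suc (toℕ i) ∣
                                             ≡⟨ ∣m+n-m+o∣≡∣n-o∣ (i′ + j′) _ _ ⟩
  ∣ toℕ j - toℕ i ∣                          ≡⟨ ∣-∣-comm (toℕ j) (toℕ i) ⟩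
  ∣ toℕ i - toℕ j ∣                          ∎
  where
  open Nat using (_+_)
  open ≡-Reasoning
  i′ = toℕ (opposite i)
  j′ = toℕ (opposite j)
  complement : (l : Fin n) → toℕ (opposite l) + suc (toℕ l) ≡ n
  complement l = trans (cong (_+ suc (toℕ l)) (opposite-prop l)) (m∸n+n≡m (toℕ<n l))
  shift : (l : Fin n) → ∀ x → n + x ≡ x + toℕ (opposite l) + suc (toℕ l)
  shift l x = trans (+-comm n x) (trans (cong (x +_) (sym (complement l))) (sym (+-assoc x _ _)))

-- Reversal of vectors and subsets

lookup-∷ʳ-fromℕ : (xs : Vec A n) (x : A) → lookup (xs ∷ʳ x) (fromℕ n) ≡ x
lookup-∷ʳ-fromℕ []       x = refl
lookup-∷ʳ-fromℕ (_ ∷ xs) x = lookup-∷ʳ-fromℕ xs x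

lookup-∷ʳ-inject₁ : (xs : Vec A n) (x : A) (i : Fin n) → lookup (xs ∷ʳ x) (inject₁ i) ≡ lookup xs i
lookup-∷ʳ-inject₁ (_ ∷ xs) x zero    = refl
lookup-∷ʳ-inject₁ (_ ∷ xs) x (suc i) = lookup-∷ʳ-inject₁ xs x i

lookup-reverse-opposite : (xs : Vec A n) (i : Fin n) → lookup (reverse xs) (opposite i) ≡ lookup xs i
lookup-reverse-opposite (x ∷ xs) zero    =
  trans (cong (λ ys → lookup ys (fromℕ _)) (reverse-∷ x xs)) (lookup-∷ʳ-fromℕ (reverse xs) x)
lookup-reverse-opposite (x ∷ xs) (suc i) =
  trans (cong (λ ys → lookup ys (inject₁ (opposite i))) (reverse-∷ x xs))
    (trans (lookup-∷ʳ-inject₁ (reverse xs) x (opposite i)) (lookup-reverse-opposite xs i))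

lookup-reverse : (xs : Vec A n) (i : Fin n) → lookup (reverse xs) i ≡ lookup xs (opposite i)
lookup-reverse xs i =
  trans (cong (lookup (reverse xs)) (sym (opposite-involutive i))) (lookup-reverse-opposite xs (opposite i))

-- The reversed vector tabulates `lookup xs ∘ opposite`, a composite of two injections.
reverse-unique : {xs : Vec A n} → Unique xs → Unique (reverse xs)
reverse-unique {xs = xs} xs! = subst Unique tabulate≡reverse (tabulate⁺ injective)
  where
  tabulate≡reverse : tabulate (lookup xs ∘ opposite) ≡ reverse xs
  tabulate≡reverse = trans (tabulate-cong (sym ∘ lookup-reverse xs)) (tabulate∘lookup (reverse xs))
  injective : ∀ {i j} → lookup xs (opposite i) ≡ lookup xs (opposite j) → i ≡ j
  injective {i} {j} eq = trans (sym (opposite-involutive i))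
    (trans (cong opposite (lookup-injective xs! _ _ eq)) (opposite-involutive j))

∈-reverse⁻ : {I : Subset k} {i : Fin k} → i ∈ reverse I → opposite i ∈ I
∈-reverse⁻ {I = I} {i} i∈ =
  lookup⇒[]= (opposite i) I (trans (sym (lookup-reverse I i)) ([]=⇒lookup i∈))

∣∷ʳ∣ : (I : Subset k) (s : Side) → ∣ I ∷ʳ s ∣ ≡ ∣ s ∷ I ∣
∣∷ʳ∣ []            s       = refl
∣∷ʳ∣ (inside  ∷ I) inside  = cong suc (∣∷ʳ∣ I inside)
∣∷ʳ∣ (inside  ∷ I) outside = cong suc (∣∷ʳ∣ I outside)
∣∷ʳ∣ (outside ∷ I) s       = ∣∷ʳ∣′ s
  where
  -- The size of `s ∷ outside ∷ I` reduces only once `s` is known, hence the split on `s`.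
  ∣∷ʳ∣′ : ∀ s → ∣ I ∷ʳ s ∣ ≡ ∣ s ∷ outside ∷ I ∣
  ∣∷ʳ∣′ inside  = ∣∷ʳ∣ I inside
  ∣∷ʳ∣′ outside = ∣∷ʳ∣ I outside

∣reverse∣ : (I : Subset k) → ∣ reverse I ∣ ≡ ∣ I ∣
∣reverse∣ []      = refl
∣reverse∣ (s ∷ I) = trans (cong ∣_∣ (reverse-∷ s I)) (trans (∣∷ʳ∣ (reverse I) s) (∣∷∣ s))
  where
  ∣∷∣ : ∀ s → ∣ s ∷ reverse I ∣ ≡ ∣ s ∷ I ∣
  ∣∷∣ inside  = cong suc (∣reverse∣ I)
  ∣∷∣ outside = ∣reverse∣ I

-- Enumerations and counting

vectors-complete : {xs : List A} → (∀ x → x List.∈ xs) → (v : Vec A n) → v List.∈ vectors xs n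
vectors-complete all []      = here refl
vectors-complete all (x ∷ v) = ∈-cartesianProductWith⁺ _∷_ (all x) (vectors-complete all v)

vectors-unique : {xs : List A} → List.Unique xs → ∀ n → List.Unique (vectors xs n)
vectors-unique xs! zero    = All.[] List.∷ List.[]
vectors-unique xs! (suc n) = Listᵤ.cartesianProductWith⁺ _∷_ ∷-injective xs! (vectors-unique xs! n)

subsets-complete : (I : Subset k) → I List.∈ subsets k
subsets-complete = vectors-complete λ { inside → here refl ; outside → there (here refl) }

-- An involution is injective, so `map f xs` is again free of repetitions; by closure both lists
-- have the same members, since each `x` is `f (f x)`. Repetition-free lists with the same members
-- are permutations of each other.
involution-↭ : {f : A → A} {xs : List A} → (∀ x → f (f x) ≡ x) → List.Unique xs →
               (∀ {x} → x List.∈ xs → f x List.∈ xs) → map f xs ↭ xs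
involution-↭ {f = f} {xs} f∘f xs! closed =
  ∼bag⇒↭ (unique∧set⇒bag (Listᵤ.map⁺ injective xs!) xs! (mk⇔ to from))
  where
  injective : ∀ {x y} → f x ≡ f y → x ≡ y
  injective {x} {y} eq = trans (sym (f∘f x)) (trans (cong f eq) (f∘f y))
  to : ∀ {x} → x List.∈ map f xs → x List.∈ xs
  to x∈ with _ , y∈ , refl ← ∈-map⁻ f x∈ = closed y∈
  from : ∀ {x} → x List.∈ xs → x List.∈ map f xs
  from {x} x∈ = subst (List._∈ map f xs) (f∘f x) (∈-map⁺ f (closed x∈))

count-map : {P : Pred B p} (P? : Decidable P) (f : A → B) (xs : List A) →
            count P? (map f xs) ≡ count (P? ∘ f) xs
count-map P? f []       = refl
count-map P? f (x ∷ xs) with does (P? (f x))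
... | true  = cong suc (count-map P? f xs)
... | false = count-map P? f xs

count-↭ : {P : Pred A p} (P? : Decidable P) {xs ys : List A} → xs ↭ ys → count P? xs ≡ count P? ys
count-↭ P? xs↭ys = ↭-length (filter-↭ P? xs↭ys)

-- Counts and maxima under reflection

count-opposite : {P : Pred (Fin k) p} {Q : Pred (Fin k) q} (P? : Decidable P) (Q? : Decidable Q) →
                 P ≐ Q ∘ opposite → count P? (allFin k) ≡ count Q? (allFin k)
count-opposite {k} P? Q? P≐Q = begin
  count P? (allFin k)                ≡⟨ cong length (filter-≐ P? (Q? ∘ opposite) P≐Q (allFin k)) ⟩
  count (Q? ∘ opposite) (allFin k)   ≡⟨ count-map Q? opposite (allFin k) ⟨
  count Q? (map opposite (allFin k)) ≡⟨ count-↭ Q? (involution-↭ opposite-involutive (Listᵤ.allFin⁺ k) (λ _ → ∈-allFin _)) ⟩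
  count Q? (allFin k)                ∎
  where open ≡-Reasoning

reverse-nonOverlapping : {P : Pred (Fin k) p} {Q : Pred (Fin k) q} → P ⊆ Q ∘ opposite →
                         NonOverlapping P ⊆ NonOverlapping Q ∘ reverse
reverse-nonOverlapping {Q = Q} P⊆Q {I} (I⊆P , apart) =
  (λ i i∈ → subst Q (opposite-involutive i) (P⊆Q (I⊆P _ (∈-reverse⁻ i∈)))) ,
  (λ i j i∈ j∈ i≢j → subst (2 ≤_) (opposite-distance i j)
    (apart _ _ (∈-reverse⁻ i∈) (∈-reverse⁻ j∈) (i≢j ∘ injective i j)))
  where
  injective : ∀ i j → opposite i ≡ opposite j → i ≡ j
  injective i j eq = trans (sym (opposite-involutive i)) (trans (cong opposite eq) (opposite-involutive j))

-- Reversing an admissible set for `P` gives an admissible set for `Q` of the same size, so every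
-- candidate on the left is matched on the right.
maxNonOverlapping-≤ : {P : Pred (Fin k) p} {Q : Pred (Fin k) q} (P? : Decidable P) (Q? : Decidable Q) →
                      P ⊆ Q ∘ opposite → maxNonOverlapping P? ≤ maxNonOverlapping Q?
maxNonOverlapping-≤ {k} P? Q? P⊆Q =
  -- `inj₁ ≤-refl` compares the two default values 0; the tabulated part handles the sizes of the
  -- admissible sets.
  max[xs]≤max[ys]⁺ 0 _ (inj₁ ≤-refl) (All.tabulate λ s∈ → inj₂ (dominated s∈))
  where
  dominated : ∀ {s} → s List.∈ map ∣_∣ (filter (nonOverlapping? P?) (subsets k)) →
              Any.Any (s ≤_) (map ∣_∣ (filter (nonOverlapping? Q?) (subsets k)))
  dominated s∈ with I , I∈ , refl ← ∈-map⁻ ∣_∣ s∈ =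
    Any.map (λ eq → ≤-reflexive (trans (sym (∣reverse∣ I)) eq))
      (∈-map⁺ ∣_∣ (∈-filter⁺ (nonOverlapping? Q?) (subsets-complete (reverse I))
        (reverse-nonOverlapping P⊆Q (proj₂ (∈-filter⁻ (nonOverlapping? P?) {xs = subsets k} I∈)))))

maxNonOverlapping-opposite : {P : Pred (Fin k) p} {Q : Pred (Fin k) q} (P? : Decidable P) (Q? : Decidable Q) →
                             P ≐ Q ∘ opposite → maxNonOverlapping P? ≡ maxNonOverlapping Q?
maxNonOverlapping-opposite {Q = Q} P? Q? (P⊆Q , Q⊆P) = ≤-antisym (maxNonOverlapping-≤ P? Q? P⊆Q)
  -- The involution turns `Q i` into `Q (opposite (opposite i))`, from which `Q⊆P` gives
  -- `P (opposite i)`.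
  (maxNonOverlapping-≤ Q? P? λ {i} Qi → Q⊆P (subst Q (sym (opposite-involutive i)) Qi))

-- The four statistics under reversal

-- Reflection sends the adjacent positions `inject₁ i` and `suc i` to `suc (opposite i)` and
-- `inject₁ (opposite i)`, where the last `opposite` acts on `Fin (pred n)`. The pair is read
-- backwards, so a rise becomes a fall.
ascent-reverse : (π : Vec (Fin m) n) (i : Fin (pred n)) → Ascent (reverse π) i ≡ Descent π (opposite i)
ascent-reverse {n = suc _} π i = cong₂ Fin._<_
  (trans (lookup-reverse π (inject₁ i)) (cong (lookup π) (opposite-inject₁ i)))
  (lookup-reverse π (suc i))

ascent-reverse-≐ : (π : Vec (Fin m) n) → Ascent (reverse π) ≐ Descent π ∘ opposite
ascent-reverse-≐ π =
  (λ {i} → subst (λ X → X) (ascent-reverse π i)) , (λ {i} → subst (λ X → X) (sym (ascent-reverse π i)))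

asc-reverse : (π : Word n) → asc (reverse π) ≡ des π
asc-reverse π = count-opposite (ascent? (reverse π)) (descent? π) (ascent-reverse-≐ π)

MNA-reverse : (π : Word n) → MNA (reverse π) ≡ MND π
MNA-reverse π = maxNonOverlapping-opposite (ascent? (reverse π)) (descent? π) (ascent-reverse-≐ π)

-- This is `asc-reverse` at the reversed word, reversal being an involution.
des-reverse : (π : Word n) → des (reverse π) ≡ asc π
des-reverse π = trans (sym (asc-reverse (reverse π))) (cong asc (reverse-involutive π))

MND-reverse : (π : Word n) → MND (reverse π) ≡ MNA π
MND-reverse π = trans (sym (MNA-reverse (reverse π))) (cong MNA (reverse-involutive π))

-- Pattern avoidance under reversal

-- Reflecting each position makes the list of positions decreasing, and reversing the list makes it
-- increasing again. The `a`-th letter selected in `π` is the `opposite a`-th one selected in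
-- `reverse π`, so all comparisons carry over.
reverse-occurrence : (τ : Word k) (π : Word n) (is : Vec (Fin n) k) →
                     Occurrence (reverse τ) (reverse π) is → Occurrence τ π (Vec.map opposite (reverse is))
reverse-occurrence τ π is (increasing , pattern-of) =
  (λ a b a<b → subst₂ Fin._<_ (sym (position a)) (sym (position b))
    (opposite-< (increasing _ _ (opposite-< a<b)))) ,
  (λ a b → subst₂ _⇔_ (cong₂ Fin._<_ (value a) (value b)) (cong₂ Fin._<_ (letter a) (letter b))
    (pattern-of (opposite a) (opposite b)))
  where
  is′ = Vec.map opposite (reverse is)
  position : ∀ a → lookup is′ a ≡ opposite (lookup is (opposite a))
  position a = trans (lookup-map a opposite (reverse is)) (cong opposite (lookup-reverse is a))
  value : ∀ a → lookup (reverse π) (lookup is (opposite a)) ≡ lookup π (lookup is′ a)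
  value a = trans (lookup-reverse π _) (cong (lookup π) (sym (position a)))
  letter : ∀ a → lookup (reverse τ) (opposite a) ≡ lookup τ a
  letter = lookup-reverse-opposite τ

reverse-avoids : (τ : Word k) (π : Word n) → Avoids τ π → Avoids (reverse τ) (reverse π)
reverse-avoids τ π avoids (is , occ) = avoids (Vec.map opposite (reverse is) , reverse-occurrence τ π is occ)

S-unique : ∀ n (τ : Word k) (ρ : Word m) → List.Unique (S n τ ρ)
S-unique n τ ρ = Listᵤ.filter⁺ _ (Listᵤ.filter⁺ isPermutation? (vectors-unique (Listᵤ.allFin⁺ n) n))

reverse-S : {π : Word n} → π List.∈ S n [213] [312] → reverse π List.∈ S n [213] [312]
reverse-S {n} {π} π∈ with ∈-filter⁻ _ {xs = permutations n} π∈
... | π∈perms , avoids₁ , avoids₂ =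
  ∈-filter⁺ _
    (∈-filter⁺ isPermutation? (vectors-complete ∈-allFin (reverse π))
      (reverse-unique (proj₂ (∈-filter⁻ isPermutation? {xs = vectors (allFin n) n} π∈perms))))
    -- `reverse [312]` computes to `[213]` and `reverse [213]` to `[312]`, so the two avoidance
    -- conditions trade places.
    (reverse-avoids [312] π avoids₂ , reverse-avoids [213] π avoids₁)

-- From the multiset of quadruples to both identities

quadruples-↭ : ∀ n → map (λ π → asc π , des π , MNA π , MND π) (S n [213] [312]) ↭
                     map (λ π → des π , asc π , MND π , MNA π) (S n [213] [312])
quadruples-↭ n = ↭-trans
  -- The first map equals the second one precomposed with `reverse`; what remains is that `reverse`
  -- permutes the list itself.
  (↭-reflexive (trans (map-cong exchange _) (map-∘ _)))
  (↭-map⁺ _ (involution-↭ reverse-involutive (S-unique n [213] [312]) reverse-S))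
  where
  exchange : (π : Word n) → (asc π , des π , MNA π , MND π) ≡
    (des (reverse π) , asc (reverse π) , MND (reverse π) , MNA (reverse π))
  exchange π = sym (cong₂ _,_ (des-reverse π) (cong₂ _,_ (asc-reverse π) (cong₂ _,_ (MND-reverse π) (MNA-reverse π))))

module _ {A : Set a} {B : Set} {xs : List A} {f g : A → B} (fxs↭gxs : map f xs ↭ map g xs) where

  count-transfer : {P : Pred B p} (P? : Decidable P) → count (P? ∘ f) xs ≡ count (P? ∘ g) xs
  count-transfer P? =
    trans (sym (count-map P? f xs)) (trans (count-↭ P? fxs↭gxs) (count-map P? g xs))

  module _ {c ℓ} (R : CommutativeSemiring c ℓ) where
    open Evaluation R
    open CommutativeSemiring R using (setoid; isEquivalence; +-isCommutativeMonoid)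
    open import Relation.Binary.Reasoning.Setoid setoid

    ∑-map : (h : B → Carrier) (f : A → B) → ∑ xs (h ∘ f) ≡ foldr _+_ 0# (map h (map f xs))
    ∑-map h f = sym (trans (cong (foldr _+_ 0#) (sym (map-∘ xs))) (foldr-map _+_ (h ∘ f) 0# xs))

    ∑-transfer : (h : B → Carrier) → ∑ xs (h ∘ f) ≈ ∑ xs (h ∘ g)
    ∑-transfer h = begin
      ∑ xs (h ∘ f)                      ≡⟨ ∑-map h f ⟩
      -- Folding the addition of a commutative monoid ignores the order of the terms.
      foldr _+_ 0# (map h (map f xs))   ≈⟨ Permutationₛ.foldr-commMonoid setoid +-isCommutativeMonoid
                                             (↭⇒↭ₛ′ isEquivalence (↭-map⁺ h fxs↭gxs)) ⟩
      foldr _+_ 0# (map h (map g xs))   ≡⟨ ∑-map h g ⟨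
      ∑ xs (h ∘ g)                      ∎

theorem14 : ∀ {c ℓ : Level} (n : ℕ) →
    Equidistributed (S n [213] [312])
    (λ π → asc π , des π , MNA π , MND π)
    (λ π → des π , asc π , MND π , MNA π)
    ×
    (∀ (R : CommutativeSemiring c ℓ) → let open Evaluation R in
    ∀ (t₁ t₂ t₃ t₄ : Carrier) →
    ∑ (S n [213] [312])
    (λ π → ((t₁ ^ asc π * t₂ ^ des π) * t₃ ^ MNA π) * t₄ ^ MND π)
    ≈
    ∑ (S n [213] [312])
    (λ π → ((t₁ ^ des π * t₂ ^ asc π) * t₃ ^ MND π) * t₄ ^ MNA π))
theorem14 n =
  (λ v → count-transfer (quadruples-↭ n) (_≟⁴ v)) ,
  (λ R t₁ t₂ t₃ t₄ → let open Evaluation R in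
    ∑-transfer (quadruples-↭ n) R
      -- Both summands are this one monomial, evaluated at the two quadruples.
      (λ (i , j , k , l) → ((t₁ ^ i * t₂ ^ j) * t₃ ^ k) * t₄ ^ l))
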